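{- Let $k\ge 2$ and let $G_1$ and $G_2$ be two $H$-consistent graphs. Then $H(G_1,G_2)$ is $k$-crossing free if and only if $$\mathsf{TS}_k(H(G_1,G_2))=\mathsf{TS}_k(G_1)\cup\mathsf{TS}_k(G_2).$$
   Context: Graphs are finite, simple, undirected and vertex-labelled (vertices are identified by their labels). For a graph $G$ and an integer $k\ge 2$, $\mathsf{TS}_k(G)$ is the graph whose nodes are all size-$k$ independent sets of $G$, two nodes $I,J$ being adjacent if there are vertices $u,v$ of $G$ with $I\setminus J=\{u\}$, $J\setminus I=\{v\}$ and $uv\in E(G)$. The union $\cup$ of two labelled graphs has as vertex set (edge set) the union of the vertex sets (edge sets). Graphs $G_1,G_2$ are $H$-consistent if the (possibly empty) set $V(G_1)\cap V(G_2)$ induces the same (possibly empty) subgraph $H$ in both $G_1$ and $G_2$. The $H$-join of $H$-consistent graphs $G_1,G_2$ is the graph $H(G_1,G_2)$ with vertex set $V(G_1)\cup V(G_2)$ and edge set consisting of $E(G_1)\cup E(G_2)$ together with all edges $vw$ with $v\in V(G_1)\setminus V(H)$ and $w\in V(G_2)\setminus V(H)$. $H(G_1,G_2)$ is $k$-crossing free if there are no $k$-element independent sets $S_1$ of $G_1$ and $S_2$ of $G_2$ with $|S_1\cap V(H)|=|S_2\cap V(H)|=|S_1\cap S_2|=k-1$. -}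

module Defs where

open import Level using (0ℓ)
open import Data.Bool.Properties using () renaming (_≟_ to _≟ᵇ_)
open import Data.Fin using (Fin)
open import Data.Fin.Properties using (all?; any?)
open import Data.Fin.Subset using (Subset; ⁅_⁆; ∣_∣; _∈_; _─_) renaming (_∩_ to _∩ˢ_)
open import Data.Fin.Subset.Properties using (_∈?_; x∈⁅x⁆; x∈⁅y⁆⇒x≡y)
open import Data.Nat using (ℕ; _∸_)
open import Data.Nat.Properties using () renaming (_≟_ to _≟ℕ_)
open import Data.Product using (∃-syntax; _×_; _,_; proj₁; proj₂)
open import Data.Sum using (_⊎_; inj₁; inj₂; [_,_]′) renaming (swap to ⊎-swap; map to ⊎-map)
open import Data.Vec using (tabulate)
open import Data.Vec.Properties using (≡-dec)
open import Function using (_∘_)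
open import Relation.Binary using (Rel; Symmetric) renaming (Decidable to Decidable₂)
import Relation.Binary as B
open import Relation.Binary.PropositionalEquality using (_≡_; sym; trans; subst)
open import Relation.Nullary using (¬_; does; ¬?; _×-dec_; _⊎-dec_; _→-dec_)
open import Relation.Unary using (Pred; Decidable; _≐_; _∪_; _∩_; _∖_)

-- A simple undirected graph whose vertices are drawn from the label type L, not
-- necessarily exhausting it.  It is only used with finite L (Fin n and
-- Subset n), so that all graphs are finite.  Decidability of the two predicates
-- says that vertex and edge sets are finite sets in the usual sense.
record Graph (L : Set) : Set₁ where
  field
    V        : Pred L 0ℓ
    E        : Rel L 0ℓ
    V?       : Decidable V
    E?       : Decidable₂ E
    E⇒V      : ∀ {u v} → E u v → V u
    E-sym    : Symmetric E
    E-irrefl : ∀ {v} → ¬ E v v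

open Graph

-- Equality of labelled graphs: same vertex set and same edge set.
infix 4 _≈ᴳ_
_≈ᴳ_ : ∀ {L} → Graph L → Graph L → Set
G ≈ᴳ G′ = (V G ≐ V G′) × (E G B.⇔ E G′)

infixr 6 _∪ᴳ_
_∪ᴳ_ : ∀ {L} → Graph L → Graph L → Graph L
G₁ ∪ᴳ G₂ = record
  { V        = V G₁ ∪ V G₂
  ; E        = λ u v → E G₁ u v ⊎ E G₂ u v
  ; V?       = λ v → V? G₁ v ⊎-dec V? G₂ v
  ; E?       = λ u v → E? G₁ u v ⊎-dec E? G₂ u v
  ; E⇒V      = ⊎-map (E⇒V G₁) (E⇒V G₂)
  ; E-sym    = ⊎-map (E-sym G₁) (E-sym G₂)
  ; E-irrefl = [ E-irrefl G₁ , E-irrefl G₂ ]′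
  }

induced : ∀ {L} (G : Graph L) {P : Pred L 0ℓ} → Decidable P → Graph L
induced G {P} P? = record
  { V        = V G ∩ P
  ; E        = λ u v → P u × P v × E G u v
  ; V?       = λ v → V? G v ×-dec P? v
  ; E?       = λ u v → P? u ×-dec P? v ×-dec E? G u v
  ; E⇒V      = λ (pu , _ , e) → E⇒V G e , pu
  ; E-sym    = λ (pu , pv , e) → pv , pu , E-sym G e
  ; E-irrefl = E-irrefl G ∘ proj₂ ∘ proj₂
  }

Consistent : ∀ {L} (H G₁ G₂ : Graph L) → Set
Consistent H G₁ G₂ = (induced G₁ common? ≈ᴳ H) × (induced G₂ common? ≈ᴳ H)
  where
  common? : Decidable (V G₁ ∩ V G₂)
  common? v = V? G₁ v ×-dec V? G₂ v

Cross : ∀ {L} (H G₁ G₂ : Graph L) → Rel L 0ℓ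
Cross H G₁ G₂ v w = (V G₁ ∖ V H) v × (V G₂ ∖ V H) w

-- The H-join H(G₁, G₂).
join : ∀ {L} (H G₁ G₂ : Graph L) → Consistent H G₁ G₂ → Graph L
join H G₁ G₂ (((common⊆H , _) , _) , _) = record
  { V        = V G₁ ∪ V G₂
  ; E        = λ u v → (E G₁ u v ⊎ E G₂ u v) ⊎ (Cross H G₁ G₂ u v ⊎ Cross H G₁ G₂ v u)
  ; V?       = λ v → V? G₁ v ⊎-dec V? G₂ v
  ; E?       = λ u v → (E? G₁ u v ⊎-dec E? G₂ u v) ⊎-dec (cross? u v ⊎-dec cross? v u)
  ; E⇒V      = [ ⊎-map (E⇒V G₁) (E⇒V G₂)
               , [ inj₁ ∘ proj₁ ∘ proj₁ , inj₂ ∘ proj₁ ∘ proj₂ ]′ ]′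
  ; E-sym    = ⊎-map (⊎-map (E-sym G₁) (E-sym G₂)) ⊎-swap
  ; E-irrefl = [ [ E-irrefl G₁ , E-irrefl G₂ ]′ , [ cross-irrefl , cross-irrefl ]′ ]′
  }
  where
  cross? : Decidable₂ (Cross H G₁ G₂)
  cross? v w = (V? G₁ v ×-dec ¬? (V? H v)) ×-dec (V? G₂ w ×-dec ¬? (V? H w))

  cross-irrefl : ∀ {v} → ¬ Cross H G₁ G₂ v v
  cross-irrefl ((v∈G₁ , v∉H) , (v∈G₂ , _)) = v∉H (common⊆H (v∈G₁ , v∈G₁ , v∈G₂))

vertexSet : ∀ {n} → Graph (Fin n) → Subset n
vertexSet G = tabulate (does ∘ V? G)

Independent : ∀ {n} → Graph (Fin n) → Pred (Subset n) 0ℓ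
Independent G S = (∀ v → v ∈ S → V G v) × (∀ u v → u ∈ S → v ∈ S → ¬ E G u v)

independent? : ∀ {n} (G : Graph (Fin n)) → Decidable (Independent G)
independent? G S =
  all? (λ v → (v ∈? S) →-dec V? G v) ×-dec
  all? (λ u → all? (λ v → (u ∈? S) →-dec ((v ∈? S) →-dec ¬? (E? G u v))))

IndependentOfSize : ∀ {n} → ℕ → Graph (Fin n) → Pred (Subset n) 0ℓ
IndependentOfSize k G S = Independent G S × ∣ S ∣ ≡ k

Slide : ∀ {n} → Graph (Fin n) → Rel (Subset n) 0ℓ
Slide G I J = ∃[ u ] ∃[ v ] (I ─ J ≡ ⁅ u ⁆) × (J ─ I ≡ ⁅ v ⁆) × E G u v

TS : ∀ {n} → ℕ → Graph (Fin n) → Graph (Subset n)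
TS {n} k G = record
  { V        = Node
  ; E        = λ I J → Node I × Node J × Slide G I J
  ; V?       = node?
  ; E?       = λ I J → node? I ×-dec node? J ×-dec slide? I J
  ; E⇒V      = proj₁
  ; E-sym    = λ (nI , nJ , u , v , p , q , e) → nJ , nI , v , u , q , p , E-sym G e
  ; E-irrefl = λ (_ , _ , u , v , p , q , e) →
      E-irrefl G (subst (E G u) (sym (same (trans (sym p) q))) e)
  }
  where
  Node : Pred (Subset n) 0ℓ
  Node = IndependentOfSize k G

  node? : Decidable Node
  node? S = independent? G S ×-dec (∣ S ∣ ≟ℕ k)

  _≟ˢ_ : Decidable₂ (_≡_ {A = Subset n})
  _≟ˢ_ = ≡-dec _≟ᵇ_

  slide? : Decidable₂ (Slide G)
  slide? I J = any? λ u → any? λ v →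
    ((I ─ J) ≟ˢ ⁅ u ⁆) ×-dec ((J ─ I) ≟ˢ ⁅ v ⁆) ×-dec E? G u v

  same : ∀ {u v : Fin n} → ⁅ u ⁆ ≡ ⁅ v ⁆ → u ≡ v
  same {u} {v} eq = x∈⁅y⁆⇒x≡y v (subst (u ∈_) eq (x∈⁅x⁆ u))

CrossingFree : ∀ {n} → ℕ → (H G₁ G₂ : Graph (Fin n)) → Set
CrossingFree k H G₁ G₂ = ¬ (∃[ S₁ ] ∃[ S₂ ]
  IndependentOfSize k G₁ S₁ × IndependentOfSize k G₂ S₂ ×
  ∣ S₁ ∩ˢ vertexSet H ∣ ≡ k ∸ 1 ×
  ∣ S₂ ∩ˢ vertexSet H ∣ ≡ k ∸ 1 ×
  ∣ S₁ ∩ˢ S₂ ∣ ≡ k ∸ 1)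

{-# OPTIONS --safe #-}

-- Because of the cross edges an independent set of H(G₁, G₂) lies inside V(G₁)
-- or inside V(G₂), and both G₁ and G₂ are induced subgraphs of H(G₁, G₂); so the
-- two sides always have the same nodes, and every edge of the union is an edge of
-- TS_k(H(G₁, G₂)).  An edge IJ of the latter, sliding u to v, can only be missing
-- from the union if, up to symmetry, I ⊆ V(G₁), J ⊆ V(G₂), u ∉ V(G₂) and
-- v ∉ V(G₁); then I ∩ V(H) = I ∩ J = J ∩ V(H), a crossing.  Conversely the two
-- sets of a crossing differ by sliding along a cross edge, while neither G₁ nor G₂
-- contains both of them.
module Submission where

open import Defs
open import Data.Fin using (Fin; zero; suc)
open import Data.Fin.Properties using (all?)
open import Data.Fin.Subset
  using (Subset; inside; outside; ⁅_⁆; ∣_∣; _∈_; _∉_; _⊆_; _─_; _∩_; ⊥)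
open import Data.Fin.Subset.Properties
open import Data.Nat using (ℕ; suc; _+_; _∸_; _≤_; s≤s; z≤n)
open import Data.Nat.Properties
  using (+-suc; +-comm; +-cancelʳ-≡; m+n∸n≡m; m+[n∸m]≡n; ≤-reflexive; ≤-trans; <⇒≱; suc-injective)
open import Data.Product using (∃-syntax; _,_; proj₁; proj₂)
open import Data.Sum using (_⊎_; inj₁; inj₂; [_,_]′)
open import Data.Vec using ([]; _∷_; here; there)
open import Data.Vec.Properties using ([]=⇒lookup; lookup⇒[]=; lookup∘tabulate)
open import Function using (_∘_)
open import Function.Bundles using (_⇔_; mk⇔)
open import Relation.Binary.PropositionalEquality
  using (_≡_; refl; sym; trans; cong; subst; module ≡-Reasoning)
open import Relation.Nullary using (¬_; yes; no; does; contradiction; _→-dec_)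
open import Relation.Nullary.Decidable using (dec-true; decidable-stable)

open Graph

private variable
  n k : ℕ

-- Cardinalities and differences of finite subsets.

x∈p─q⇒x∉q : ∀ {x : Fin n} (p q : Subset n) → x ∈ p ─ q → x ∉ q
x∈p─q⇒x∉q (_ ∷ p) (_ ∷ q) (there x∈) (there x∈q) = x∈p─q⇒x∉q p q x∈ x∈q
x∈p─q⇒x∉q (inside  ∷ p) (_ ∷ q) () here
x∈p─q⇒x∉q (outside ∷ p) (_ ∷ q) () here

∣p∩q∣+∣p─q∣≡∣p∣ : ∀ (p q : Subset n) → ∣ p ∩ q ∣ + ∣ p ─ q ∣ ≡ ∣ p ∣
∣p∩q∣+∣p─q∣≡∣p∣ [] [] = refl
∣p∩q∣+∣p─q∣≡∣p∣ (outside ∷ p) (outside ∷ q) = ∣p∩q∣+∣p─q∣≡∣p∣ p q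
∣p∩q∣+∣p─q∣≡∣p∣ (outside ∷ p) (inside  ∷ q) = ∣p∩q∣+∣p─q∣≡∣p∣ p q
∣p∩q∣+∣p─q∣≡∣p∣ (inside  ∷ p) (outside ∷ q) =
  trans (+-suc ∣ p ∩ q ∣ ∣ p ─ q ∣) (cong suc (∣p∩q∣+∣p─q∣≡∣p∣ p q))
∣p∩q∣+∣p─q∣≡∣p∣ (inside  ∷ p) (inside  ∷ q) = cong suc (∣p∩q∣+∣p─q∣≡∣p∣ p q)

∣p∣≡0⇒p≡⊥ : (p : Subset n) → ∣ p ∣ ≡ 0 → p ≡ ⊥
∣p∣≡0⇒p≡⊥ []            _ = refl
∣p∣≡0⇒p≡⊥ (outside ∷ p) e = cong (outside ∷_) (∣p∣≡0⇒p≡⊥ p e)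

∣p∣≡1⇒p≡⁅x⁆ : (p : Subset n) → ∣ p ∣ ≡ 1 → ∃[ x ] p ≡ ⁅ x ⁆
∣p∣≡1⇒p≡⁅x⁆ (inside  ∷ p) e = zero , cong (inside ∷_) (∣p∣≡0⇒p≡⊥ p (suc-injective e))
∣p∣≡1⇒p≡⁅x⁆ (outside ∷ p) e with x , p≡⁅x⁆ ← ∣p∣≡1⇒p≡⁅x⁆ p e = suc x , cong (outside ∷_) p≡⁅x⁆

p⊆q∧∣q∣≤∣p∣⇒q⊆p : {p q : Subset n} → p ⊆ q → ∣ q ∣ ≤ ∣ p ∣ → q ⊆ p
p⊆q∧∣q∣≤∣p∣⇒q⊆p {p = p} p⊆q ∣q∣≤∣p∣ {x} x∈q = decidable-stable (x ∈? p) λ x∉p →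
  <⇒≱ (p⊂q⇒∣p∣<∣q∣ (p⊆q , x , x∈q , x∉p)) ∣q∣≤∣p∣

p─q≡⁅x⁆⇒x∈p : ∀ (p q : Subset n) {x} → p ─ q ≡ ⁅ x ⁆ → x ∈ p
p─q≡⁅x⁆⇒x∈p p q {x} eq = p─q⊆p p q (subst (x ∈_) (sym eq) (x∈⁅x⁆ x))

p─q≡⁅x⁆⇒x∉q : ∀ (p q : Subset n) {x} → p ─ q ≡ ⁅ x ⁆ → x ∉ q
p─q≡⁅x⁆⇒x∉q p q {x} eq = x∈p─q⇒x∉q p q (subst (x ∈_) (sym eq) (x∈⁅x⁆ x))

p─q≡⁅x⁆⇒∣p∩q∣≡∣p∣∸1 : ∀ (p q : Subset n) {x} → p ─ q ≡ ⁅ x ⁆ → ∣ p ∩ q ∣ ≡ ∣ p ∣ ∸ 1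
p─q≡⁅x⁆⇒∣p∩q∣≡∣p∣∸1 p q {x} eq = begin
  ∣ p ∩ q ∣                     ≡⟨ m+n∸n≡m ∣ p ∩ q ∣ 1 ⟨
  ∣ p ∩ q ∣ + 1 ∸ 1             ≡⟨ cong (λ m → ∣ p ∩ q ∣ + m ∸ 1) (trans (cong ∣_∣ eq) (∣⁅x⁆∣≡1 x)) ⟨
  ∣ p ∩ q ∣ + ∣ p ─ q ∣ ∸ 1     ≡⟨ cong (_∸ 1) (∣p∩q∣+∣p─q∣≡∣p∣ p q) ⟩
  ∣ p ∣ ∸ 1                     ∎
  where open ≡-Reasoning

-- The bound `1 ≤ ∣ p ∣` guards the truncated subtraction: for empty `p` the equation reads `0 ≡ 0`
-- although `p ─ q` is empty.
∣p∩q∣≡∣p∣∸1⇒p─q≡⁅x⁆ : ∀ (p q : Subset n) → 1 ≤ ∣ p ∣ → ∣ p ∩ q ∣ ≡ ∣ p ∣ ∸ 1 →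
  ∃[ x ] p ─ q ≡ ⁅ x ⁆
∣p∩q∣≡∣p∣∸1⇒p─q≡⁅x⁆ p q 1≤∣p∣ eq = ∣p∣≡1⇒p≡⁅x⁆ (p ─ q) (+-cancelʳ-≡ ∣ p ∩ q ∣ ∣ p ─ q ∣ 1 (begin
  ∣ p ─ q ∣ + ∣ p ∩ q ∣   ≡⟨ +-comm ∣ p ─ q ∣ ∣ p ∩ q ∣ ⟩
  ∣ p ∩ q ∣ + ∣ p ─ q ∣   ≡⟨ ∣p∩q∣+∣p─q∣≡∣p∣ p q ⟩
  ∣ p ∣                   ≡⟨ m+[n∸m]≡n 1≤∣p∣ ⟨
  1 + (∣ p ∣ ∸ 1)         ≡⟨ cong (1 +_) eq ⟨
  1 + ∣ p ∩ q ∣           ∎))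
  where open ≡-Reasoning

-- Every element of `p` other than `x` lies in `q`. With `P` the vertex set of a part, a slide stays
-- in that part as soon as the moved vertex does.
p─q≡⁅x⁆⇒p⊆P : ∀ (p q : Subset n) {x} {P : Fin n → Set} → p ─ q ≡ ⁅ x ⁆ →
  P x → (∀ y → y ∈ q → P y) → ∀ y → y ∈ p → P y
p─q≡⁅x⁆⇒p⊆P p q {x} {P} eq Px q⊆P y y∈p with y ∈? q
... | yes y∈q = q⊆P y y∈q
... | no  y∉q = subst P (sym (x∈⁅y⁆⇒x≡y x (subst (y ∈_) eq (x∈p∧x∉q⇒x∈p─q y∈p y∉q)))) Px

∈vertexSet⁺ : ∀ (G : Graph (Fin n)) {v} → V G v → v ∈ vertexSet G
∈vertexSet⁺ G {v} v∈G = lookup⇒[]= v (vertexSet G)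
  (trans (lookup∘tabulate (does ∘ V? G) v) (dec-true (V? G v) v∈G))

∈vertexSet⁻ : ∀ (G : Graph (Fin n)) {v} → v ∈ vertexSet G → V G v
∈vertexSet⁻ G {v} v∈
  with V? G v | trans (sym (lookup∘tabulate (does ∘ V? G) v)) ([]=⇒lookup v∈)
... | yes v∈G | _ = v∈G
... | no  _   | ()

-- Induced subgraphs and token sliding.

record _InducedIn_ {L : Set} (G K : Graph L) : Set where
  field
    V⊆ : ∀ {v} → V G v → V K v
    E⊆ : ∀ {u v} → E G u v → E K u v
    E⊇ : ∀ {u v} → V G u → V G v → E K u v → E G u v

open _InducedIn_

module _ {G K : Graph (Fin n)} (G≤K : G InducedIn K) where

  node-extend : ∀ {S} → IndependentOfSize k G S → IndependentOfSize k K S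
  node-extend ((S⊆G , ind) , size) =
    ((λ v v∈S → V⊆ G≤K (S⊆G v v∈S)) ,
     (λ u v u∈S v∈S → ind u v u∈S v∈S ∘ E⊇ G≤K (S⊆G u u∈S) (S⊆G v v∈S))) ,
    size

  node-restrict : ∀ {S} → IndependentOfSize k K S → (∀ v → v ∈ S → V G v) → IndependentOfSize k G S
  node-restrict ((_ , ind) , size) S⊆G = (S⊆G , λ u v u∈S v∈S → ind u v u∈S v∈S ∘ E⊆ G≤K) , size

  TS-edge-extend : ∀ {I J} → E (TS k G) I J → E (TS k K) I J
  TS-edge-extend (I∈ , J∈ , u , v , I─J , J─I , e) =
    node-extend I∈ , node-extend J∈ , u , v , I─J , J─I , E⊆ G≤K e

  -- The slid edge has its ends in `I` and in `J`, hence in `G`, where `K` has no further edges.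
  TS-edge-restrict : ∀ {I J} → E (TS k K) I J →
    IndependentOfSize k G I → IndependentOfSize k G J → E (TS k G) I J
  TS-edge-restrict {I = I} {J} (_ , _ , u , v , I─J , J─I , e) I∈@((I⊆G , _) , _) J∈@((J⊆G , _) , _) =
    I∈ , J∈ , u , v , I─J , J─I ,
    E⊇ G≤K (I⊆G u (p─q≡⁅x⁆⇒x∈p I J I─J)) (J⊆G v (p─q≡⁅x⁆⇒x∈p J I J─I)) e

-- The two parts of an H-join.

module _ (H G₁ G₂ : Graph (Fin n)) (c : Consistent H G₁ G₂) where

  private
    K : Graph (Fin n)
    K = join H G₁ G₂ c

  H⇒G₁ : ∀ {v} → V H v → V G₁ v
  H⇒G₁ v∈H = proj₁ (proj₂ (proj₁ (proj₁ c)) v∈H)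

  H⇒G₂ : ∀ {v} → V H v → V G₂ v
  H⇒G₂ v∈H = proj₁ (proj₂ (proj₁ (proj₂ c)) v∈H)

  G₁∩G₂⇒H : ∀ {v} → V G₁ v → V G₂ v → V H v
  G₁∩G₂⇒H v∈G₁ v∈G₂ = proj₁ (proj₁ (proj₁ c)) (v∈G₁ , v∈G₁ , v∈G₂)

  -- The edge has both ends in the common vertex set, so it passes through `H`, which both graphs
  -- induce there.
  E₁⇒E₂ : ∀ {u v} → V G₂ u → V G₂ v → E G₁ u v → E G₂ u v
  E₁⇒E₂ u∈G₂ v∈G₂ e = proj₂ (proj₂ (proj₂ (proj₂ (proj₂ c))
    (proj₁ (proj₂ (proj₁ c)) ((E⇒V G₁ e , u∈G₂) , (E⇒V G₁ (E-sym G₁ e) , v∈G₂) , e))))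

  E₂⇒E₁ : ∀ {u v} → V G₁ u → V G₁ v → E G₂ u v → E G₁ u v
  E₂⇒E₁ u∈G₁ v∈G₁ e = proj₂ (proj₂ (proj₂ (proj₂ (proj₁ c))
    (proj₁ (proj₂ (proj₂ c)) ((u∈G₁ , E⇒V G₂ e) , (v∈G₁ , E⇒V G₂ (E-sym G₂ e)) , e))))

  -- A cross edge has an end in `G₂` outside `H`; if that end were also in `G₁`, it would be common
  -- and so in `H`.
  G₁-induced : G₁ InducedIn K
  G₁-induced = record
    { V⊆ = inj₁
    ; E⊆ = inj₁ ∘ inj₁
    ; E⊇ = λ u∈ v∈ → λ where
        (inj₁ (inj₁ e)) → e
        (inj₁ (inj₂ e)) → E₂⇒E₁ u∈ v∈ e
        (inj₂ (inj₁ (_ , v∈G₂ , v∉H))) → contradiction (G₁∩G₂⇒H v∈ v∈G₂) v∉H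
        (inj₂ (inj₂ (_ , u∈G₂ , u∉H))) → contradiction (G₁∩G₂⇒H u∈ u∈G₂) u∉H
    }

  G₂-induced : G₂ InducedIn K
  G₂-induced = record
    { V⊆ = inj₂
    ; E⊆ = inj₁ ∘ inj₂
    ; E⊇ = λ u∈ v∈ → λ where
        (inj₁ (inj₁ e)) → E₁⇒E₂ u∈ v∈ e
        (inj₁ (inj₂ e)) → e
        (inj₂ (inj₁ ((u∈G₁ , u∉H) , _))) → contradiction (G₁∩G₂⇒H u∈G₁ u∈) u∉H
        (inj₂ (inj₂ ((v∈G₁ , v∉H) , _))) → contradiction (G₁∩G₂⇒H v∈G₁ v∈) v∉H
    }

  cross : ∀ {u v} → V G₁ u → ¬ V G₂ u → V G₂ v → ¬ V G₁ v → Cross H G₁ G₂ u v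
  cross u∈G₁ u∉G₂ v∈G₂ v∉G₁ = (u∈G₁ , u∉G₂ ∘ H⇒G₂) , (v∈G₂ , v∉G₁ ∘ H⇒G₁)

  independent-in-part : ∀ {S} → Independent K S → (∀ v → v ∈ S → V G₁ v) ⊎ (∀ v → v ∈ S → V G₂ v)
  independent-in-part {S} (S⊆K , ind) with all? (λ v → (v ∈? S) →-dec V? G₁ v)
  ... | yes S⊆G₁ = inj₁ S⊆G₁
  -- The refutation `S⊈G₁` provides no explicit vertex outside `G₁`, so both memberships are proved
  -- by contradiction, using their decidability. The assumed `u` and `v` are then joined by a cross
  -- edge.
  ... | no  S⊈G₁ = inj₂ λ u u∈S → decidable-stable (V? G₂ u) λ u∉G₂ →
    S⊈G₁ λ v v∈S → decidable-stable (V? G₁ v) λ v∉G₁ →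
      ind u v u∈S v∈S (inj₂ (inj₁ (cross
        ([ (λ u∈G₁ → u∈G₁) , (λ u∈G₂ → contradiction u∈G₂ u∉G₂) ]′ (S⊆K u u∈S)) u∉G₂
        ([ (λ v∈G₁ → contradiction v∈G₁ v∉G₁) , (λ v∈G₂ → v∈G₂) ]′ (S⊆K v v∈S)) v∉G₁)))

  node-in-part : ∀ {S} → IndependentOfSize k K S → IndependentOfSize k G₁ S ⊎ IndependentOfSize k G₂ S
  node-in-part S∈@(ind , _) with independent-in-part ind
  ... | inj₁ S⊆G₁ = inj₁ (node-restrict G₁-induced S∈ S⊆G₁)
  ... | inj₂ S⊆G₂ = inj₂ (node-restrict G₂-induced S∈ S⊆G₂)

  -- From crossing freeness to the equality.

  -- The only element of `p` outside `q` is `x`, which is not in `H`, so the elements of `p` in `H`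
  -- all lie in `q`.
  p∩H≡p∩q : ∀ (p q : Subset n) {x} → p ─ q ≡ ⁅ x ⁆ → ¬ V H x →
    (∀ y → y ∈ p → y ∈ q → V H y) → p ∩ vertexSet H ≡ p ∩ q
  p∩H≡p∩q p q {x} p─q x∉H p∩q⊆H = ⊆-antisym to from
    where
    to : p ∩ vertexSet H ⊆ p ∩ q
    to {y} y∈ with y∈p , y∈H ← x∈p∩q⁻ p (vertexSet H) y∈ =
      x∈p∩q⁺ (y∈p , decidable-stable (y ∈? q) λ y∉q →
        x∉H (subst (V H) (x∈⁅y⁆⇒x≡y x (subst (y ∈_) p─q (x∈p∧x∉q⇒x∈p─q y∈p y∉q))) (∈vertexSet⁻ H y∈H)))
    from : p ∩ q ⊆ p ∩ vertexSet H
    from {y} y∈ with y∈p , y∈q ← x∈p∩q⁻ p q y∈ = x∈p∩q⁺ (y∈p , ∈vertexSet⁺ H (p∩q⊆H y y∈p y∈q))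

  -- If both alternatives fail, neither `u` nor `v` is in `H`, and `I`, `J` form a crossing. Either
  -- alternative places both nodes in a single part.
  slide-parts : ∀ {I J u v} → CrossingFree k H G₁ G₂ →
    IndependentOfSize k G₁ I → IndependentOfSize k G₂ J →
    I ─ J ≡ ⁅ u ⁆ → J ─ I ≡ ⁅ v ⁆ → V G₂ u ⊎ V G₁ v
  slide-parts {k} {I} {J} {u} {v} free I∈@((I⊆G₁ , _) , ∣I∣≡k) J∈@((J⊆G₂ , _) , ∣J∣≡k) I─J J─I
    with V? G₂ u | V? G₁ v
  ... | yes u∈G₂ | _        = inj₁ u∈G₂
  ... | no  _    | yes v∈G₁ = inj₂ v∈G₁
  ... | no  u∉G₂ | no  v∉G₁ = contradiction
    (I , J , I∈ , J∈ ,
     trans (cong ∣_∣ (p∩H≡p∩q I J I─J (u∉G₂ ∘ H⇒G₂) λ y y∈I y∈J → G₁∩G₂⇒H (I⊆G₁ y y∈I) (J⊆G₂ y y∈J)))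
       (size I J ∣I∣≡k I─J) ,
     trans (cong ∣_∣ (p∩H≡p∩q J I J─I (v∉G₁ ∘ H⇒G₁) λ y y∈J y∈I → G₁∩G₂⇒H (I⊆G₁ y y∈I) (J⊆G₂ y y∈J)))
       (size J I ∣J∣≡k J─I) ,
     size I J ∣I∣≡k I─J) free
    where
    size : ∀ (p q : Subset n) {x} → ∣ p ∣ ≡ k → p ─ q ≡ ⁅ x ⁆ → ∣ p ∩ q ∣ ≡ k ∸ 1
    size p q ∣p∣≡k p─q = trans (p─q≡⁅x⁆⇒∣p∩q∣≡∣p∣∸1 p q p─q) (cong (_∸ 1) ∣p∣≡k)

  TS-edge-mixed : ∀ {I J} → CrossingFree k H G₁ G₂ → E (TS k K) I J →
    IndependentOfSize k G₁ I → IndependentOfSize k G₂ J → E (TS k G₁ ∪ᴳ TS k G₂) I J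
  TS-edge-mixed {I = I} {J} free e@(I∈ , J∈ , u , v , I─J , J─I , _) I∈₁@((I⊆G₁ , _) , _) J∈₂@((J⊆G₂ , _) , _)
    with slide-parts free I∈₁ J∈₂ I─J J─I
  -- Here `I` consists of `u` and elements of `J`, so it lies in `G₂` as well.
  ... | inj₁ u∈G₂ = inj₂ (TS-edge-restrict G₂-induced e
          (node-restrict G₂-induced I∈ (p─q≡⁅x⁆⇒p⊆P I J I─J u∈G₂ J⊆G₂)) J∈₂)
  ... | inj₂ v∈G₁ = inj₁ (TS-edge-restrict G₁-induced e I∈₁
          (node-restrict G₁-induced J∈ (p─q≡⁅x⁆⇒p⊆P J I J─I v∈G₁ I⊆G₁)))

  TS-edge-in-part : ∀ {I J} → CrossingFree k H G₁ G₂ → E (TS k K) I J → E (TS k G₁ ∪ᴳ TS k G₂) I J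
  TS-edge-in-part {k} free e@(I∈ , J∈ , _) with node-in-part I∈ | node-in-part J∈
  ... | inj₁ I∈₁ | inj₁ J∈₁ = inj₁ (TS-edge-restrict G₁-induced e I∈₁ J∈₁)
  ... | inj₂ I∈₂ | inj₂ J∈₂ = inj₂ (TS-edge-restrict G₂-induced e I∈₂ J∈₂)
  ... | inj₁ I∈₁ | inj₂ J∈₂ = TS-edge-mixed free e I∈₁ J∈₂
  ... | inj₂ I∈₂ | inj₁ J∈₁ =
    E-sym (TS k G₁ ∪ᴳ TS k G₂) (TS-edge-mixed free (E-sym (TS k K) e) J∈₁ I∈₂)

  crossingFree⇒TS : CrossingFree k H G₁ G₂ → TS k K ≈ᴳ TS k G₁ ∪ᴳ TS k G₂
  crossingFree⇒TS free =
    (node-in-part , [ node-extend G₁-induced , node-extend G₂-induced ]′) ,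
    (TS-edge-in-part free , [ TS-edge-extend G₁-induced , TS-edge-extend G₂-induced ]′)

  -- From the equality to crossing freeness.

  -- The inclusion of `p ∩ q` in `p ∩ vertexSet H` is between sets of equal size, hence an equality;
  -- with `x` in `H` this would put `x` in `q`.
  ∣p∩H∣≡∣p∩q∣⇒x∉H : ∀ (p q : Subset n) {x} → p ─ q ≡ ⁅ x ⁆ →
    (∀ y → y ∈ p → y ∈ q → V H y) → ∣ p ∩ vertexSet H ∣ ≡ ∣ p ∩ q ∣ → ¬ V H x
  ∣p∩H∣≡∣p∩q∣⇒x∉H p q {x} p─q p∩q⊆H eq x∈H = p─q≡⁅x⁆⇒x∉q p q p─q
    (proj₂ (x∈p∩q⁻ p q (p⊆q∧∣q∣≤∣p∣⇒q⊆p p∩q⊆p∩H (≤-reflexive eq)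
      (x∈p∩q⁺ (p─q≡⁅x⁆⇒x∈p p q p─q , ∈vertexSet⁺ H x∈H)))))
    where
    p∩q⊆p∩H : p ∩ q ⊆ p ∩ vertexSet H
    p∩q⊆p∩H {y} y∈ with y∈p , y∈q ← x∈p∩q⁻ p q y∈ = x∈p∩q⁺ (y∈p , ∈vertexSet⁺ H (p∩q⊆H y y∈p y∈q))

  TS⇒crossingFree : 1 ≤ k → TS k K ≈ᴳ TS k G₁ ∪ᴳ TS k G₂ → CrossingFree k H G₁ G₂
  TS⇒crossingFree {k} 1≤k (_ , TS-edge , _)
    (S₁ , S₂ , S₁∈@((S₁⊆G₁ , _) , ∣S₁∣≡k) , S₂∈@((S₂⊆G₂ , _) , ∣S₂∣≡k) , ∣S₁∩H∣ , ∣S₂∩H∣ , ∣S₁∩S₂∣) =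
    -- The slide must be an edge of one part's graph. In the first, `S₂` lies in `G₁` and `v`
    -- becomes a common vertex; in the second, `S₁` lies in `G₂` and `u` does. Common vertices are
    -- in `H`.
    [ (λ (_ , ((S₂⊆G₁ , _) , _) , _) → v∉H (G₁∩G₂⇒H (S₂⊆G₁ v v∈S₂) (S₂⊆G₂ v v∈S₂)))
    , (λ (((S₁⊆G₂ , _) , _) , _) → u∉H (G₁∩G₂⇒H (S₁⊆G₁ u u∈S₁) (S₁⊆G₂ u u∈S₁)))
    ]′ (TS-edge
      (node-extend G₁-induced S₁∈ , node-extend G₂-induced S₂∈ , u , v , S₁─S₂ , S₂─S₁ ,
       inj₂ (inj₁ ((S₁⊆G₁ u u∈S₁ , u∉H) , (S₂⊆G₂ v v∈S₂ , v∉H)))))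
    where
    ∣S₂∩S₁∣ : ∣ S₂ ∩ S₁ ∣ ≡ k ∸ 1
    ∣S₂∩S₁∣ = trans (cong ∣_∣ (∩-comm S₂ S₁)) ∣S₁∩S₂∣

    difference : ∀ (p q : Subset n) → ∣ p ∣ ≡ k → ∣ p ∩ q ∣ ≡ k ∸ 1 → ∃[ x ] p ─ q ≡ ⁅ x ⁆
    difference p q refl = ∣p∩q∣≡∣p∣∸1⇒p─q≡⁅x⁆ p q 1≤k

    u v : Fin n
    u = proj₁ (difference S₁ S₂ ∣S₁∣≡k ∣S₁∩S₂∣)
    v = proj₁ (difference S₂ S₁ ∣S₂∣≡k ∣S₂∩S₁∣)

    S₁─S₂ : S₁ ─ S₂ ≡ ⁅ u ⁆
    S₁─S₂ = proj₂ (difference S₁ S₂ ∣S₁∣≡k ∣S₁∩S₂∣)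

    S₂─S₁ : S₂ ─ S₁ ≡ ⁅ v ⁆
    S₂─S₁ = proj₂ (difference S₂ S₁ ∣S₂∣≡k ∣S₂∩S₁∣)

    u∈S₁ : u ∈ S₁
    u∈S₁ = p─q≡⁅x⁆⇒x∈p S₁ S₂ S₁─S₂

    v∈S₂ : v ∈ S₂
    v∈S₂ = p─q≡⁅x⁆⇒x∈p S₂ S₁ S₂─S₁

    u∉H : ¬ V H u
    u∉H = ∣p∩H∣≡∣p∩q∣⇒x∉H S₁ S₂ S₁─S₂
      (λ y y∈S₁ y∈S₂ → G₁∩G₂⇒H (S₁⊆G₁ y y∈S₁) (S₂⊆G₂ y y∈S₂)) (trans ∣S₁∩H∣ (sym ∣S₁∩S₂∣))

    v∉H : ¬ V H v
    v∉H = ∣p∩H∣≡∣p∩q∣⇒x∉H S₂ S₁ S₂─S₁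
      (λ y y∈S₂ y∈S₁ → G₁∩G₂⇒H (S₁⊆G₁ y y∈S₁) (S₂⊆G₂ y y∈S₂)) (trans ∣S₂∩H∣ (sym ∣S₂∩S₁∣))

corollary13 : ∀ (n k : ℕ) → 2 ≤ k → (H G₁ G₂ : Graph (Fin n)) (c : Consistent H G₁ G₂) →
    CrossingFree k H G₁ G₂ ⇔ (TS k (join H G₁ G₂ c) ≈ᴳ TS k G₁ ∪ᴳ TS k G₂)
corollary13 n k 2≤k H G₁ G₂ c =
  mk⇔ (crossingFree⇒TS H G₁ G₂ c) (TS⇒crossingFree H G₁ G₂ c (≤-trans (s≤s z≤n) 2≤k))
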